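{- Let $p$ and $p'$ be consecutive patterns of the same length that are both non-overlapping and are interchangeable. Then $p$ and $p'$ are super-strongly Wilf equivalent.
   Context: An inversion sequence of length $n$ is an integer sequence $e=e_1e_2\dots e_n$ with $0\le e_i<i$ for all $i$; $\mathbf{I}_n$ denotes the set of these. A pattern of length $r$ is a sequence $p=p_1\dots p_r$ with $p_i\in\{0,\dots,r-1\}$ such that whenever a value $j>0$ appears in $p$, the value $j-1$ also appears. The reduction of an integer word $w$ is obtained by replacing every occurrence of the $i$-th smallest distinct value of $w$ by $i-1$. An inversion sequence $e$ has an occurrence of the consecutive pattern $p$ in position $i$ if the reduction of $e_i\dots e_{i+r-1}$ equals $p$; $\mathrm{Em}(p,e)$ is the set of such positions. $p=p_1\dots p_r$ is non-overlapping if for every $1<i<r$ the reductions of $p_1\dots p_i$ and $p_{r-i+1}\dots p_r$ differ. Given patterns $p,p'$ of length $r$ with $p_1=p'_1$, $p_r=p'_r$ and $\max_i p_i=\max_i p'_i$, $p$ is changeable for $p'$ if for all $1\le i\le r$, $p'_i\le\max(\{p_j:1\le j\le i\}\cup\{p_j-j+i: i<j\le r\})$; $p$ and $p'$ are interchangeable if each is changeable for the other. Two patterns are super-strongly Wilf equivalent if $|\{e\in\mathbf{I}_n:\mathrm{Em}(p,e)=T\}|=|\{e\in\mathbf{I}_n:\mathrm{Em}(p',e)=T\}|$ for all $n$ and all $T\subseteq[n]$. -}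

module Defs where

open import Data.Bool.Properties using () renaming (_≟_ to _≟ᵇ_)
open import Data.Fin.Base as Fin using (Fin; zero; suc; toℕ; inject₁; fromℕ)
import Data.Fin.Properties as Fin
open import Data.Fin.Relation.Unary.Top using (view; ‵fromℕ; ‵inject₁)
open import Data.Fin.Subset using (Subset)
open import Data.List.Base
  using (List; []; _∷_; _++_; length; map; filter; deduplicate; take; drop;
         upTo; allFin; cartesianProductWith)
open import Data.List.Extrema.Nat using (max)
import Data.List.Membership.Propositional as List
import Data.List.Membership.Propositional.Properties as List
import Data.List.Properties as List
open import Data.List.Relation.Unary.All using ([])
open import Data.List.Relation.Unary.AllPairs using ([]; _∷_)
open import Data.List.Relation.Unary.Any using (here)
open import Data.List.Relation.Unary.Unique.Propositional using (Unique)
import Data.List.Relation.Unary.Unique.Propositional.Properties as Unique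
open import Data.Nat.Base using (ℕ; zero; suc; _+_; _∸_; _≤_; _<_)
open import Data.Nat.Properties using (_≟_; _<?_)
open import Data.Product.Base using (_×_; _,_)
open import Data.Vec.Base as Vec using (Vec; []; _∷_; _∷ʳ_; lookup; toList; tabulate)
open import Data.Vec.Membership.Propositional using (_∈_)
import Data.Vec.Properties as Vec
open import Function.Bundles using (_⇔_; mk⇔)
open import Relation.Binary.PropositionalEquality
  using (_≡_; _≢_; refl; sym; subst₂)
open import Relation.Nullary using (Dec; does)

-- Everything is indexed from 0: the entry e_i of the mathematics is
-- `lookup e` at the element of `Fin n` whose value is i - 1.

IsInversionSequence : ∀ {n} → Vec ℕ n → Set
IsInversionSequence e = ∀ i → lookup e i < suc (toℕ i)

-- The set I_n, listed without repetition (see the two lemmas below).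
inversionSequences : ∀ n → List (Vec ℕ n)
inversionSequences zero    = [] ∷ []
inversionSequences (suc n) =
  cartesianProductWith _∷ʳ_ (inversionSequences n) (upTo (suc n))

record IsPattern {r} (p : Vec ℕ r) : Set where
  field
    bounded    : ∀ i → lookup p i < r
    downClosed : ∀ j → suc j ∈ p → j ∈ p

-- The number of distinct values of w below x; hence x is replaced by i - 1
-- when it is the i-th smallest distinct value of w.
rank : List ℕ → ℕ → ℕ
rank w x = length (deduplicate _≟_ (filter (_<? x) w))

reduction : List ℕ → List ℕ
reduction w = map (rank w) w

factor : ∀ {n} → Vec ℕ n → ℕ → ℕ → List ℕ
factor e i r = take r (drop i (toList e))

-- When fewer than r letters of e remain from position i on, the factor is
-- shorter than p and so, `reduction` preserving length, p does not occur.
OccursAt : ∀ {r n} → Vec ℕ r → Vec ℕ n → Fin n → Set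
OccursAt {r} p e i = reduction (factor e (toℕ i) r) ≡ toList p

occursAt? : ∀ {r n} (p : Vec ℕ r) (e : Vec ℕ n) i → Dec (OccursAt p e i)
occursAt? p e i = List.≡-dec _≟_ _ _

Em : ∀ {r n} → Vec ℕ r → Vec ℕ n → Subset n
Em p e = tabulate λ i → does (occursAt? p e i)

NonOverlapping : ∀ {r} → Vec ℕ r → Set
NonOverlapping {r} p = ∀ i → 1 < i → i < r →
  reduction (take i (toList p)) ≢ reduction (drop (r ∸ i) (toList p))

maximum : ∀ {r} → Vec ℕ r → ℕ
maximum p = max 0 (toList p)

-- max ({p_j : j ≤ i} ∪ {p_j - j + i : i < j}).  The first set is a nonempty
-- set of naturals, so neither truncating the subtraction at 0 nor the
-- default value 0 of `max` affects the result.
changeBound : ∀ {r} → Vec ℕ r → Fin r → ℕ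
changeBound {r} p i = max 0
  (  map (lookup p) (filter (Fin._≤? i) (allFin r))
  ++ map (λ j → (lookup p j + toℕ i) ∸ toℕ j) (filter (i Fin.<?_) (allFin r)))

record Changeable {r} (p p′ : Vec ℕ (suc r)) : Set where
  field
    sameFirst   : Vec.head p ≡ Vec.head p′
    sameLast    : Vec.last p ≡ Vec.last p′
    sameMaximum : maximum p ≡ maximum p′
    change      : ∀ i → lookup p′ i ≤ changeBound p i

Interchangeable : ∀ {r} → Vec ℕ (suc r) → Vec ℕ (suc r) → Set
Interchangeable p p′ = Changeable p p′ × Changeable p′ p

-- |{e ∈ I_n : Em(p,e) = T}|
countEm : ∀ {r n} → Vec ℕ r → Subset n → ℕ
countEm {n = n} p T =
  length (filter (λ e → Vec.≡-dec _≟ᵇ_ (Em p e) T) (inversionSequences n))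

SuperStronglyWilfEquivalent : ∀ {r} → Vec ℕ r → Vec ℕ r → Set
SuperStronglyWilfEquivalent p p′ =
  ∀ n (T : Subset n) → countEm p T ≡ countEm p′ T

private
  lookup-∷ʳ-inject₁ : ∀ {n} (e : Vec ℕ n) x i → lookup (e ∷ʳ x) (inject₁ i) ≡ lookup e i
  lookup-∷ʳ-inject₁ (y ∷ e) x zero    = refl
  lookup-∷ʳ-inject₁ (y ∷ e) x (suc i) = lookup-∷ʳ-inject₁ e x i

  lookup-∷ʳ-fromℕ : ∀ {n} (e : Vec ℕ n) x → lookup (e ∷ʳ x) (fromℕ n) ≡ x
  lookup-∷ʳ-fromℕ []      x = refl
  lookup-∷ʳ-fromℕ (y ∷ e) x = lookup-∷ʳ-fromℕ e x

  complete : ∀ {n} (e : Vec ℕ n) → IsInversionSequence e → e List.∈ inversionSequences n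
  complete {zero}  []  _ = here refl
  complete {suc n} e   h with Vec.initLast e
  ... | e₀ , x , refl = List.∈-cartesianProductWith⁺ _∷ʳ_
    (complete e₀ λ i → subst₂ (λ a b → a < suc b)
      (lookup-∷ʳ-inject₁ e₀ x i) (Fin.toℕ-inject₁ i) (h (inject₁ i)))
    (List.∈-upTo⁺ (subst₂ (λ a b → a < suc b)
      (lookup-∷ʳ-fromℕ e₀ x) (Fin.toℕ-fromℕ n) (h (fromℕ n))))

  sound : ∀ {n} (e : Vec ℕ n) → e List.∈ inversionSequences n → IsInversionSequence e
  sound {suc n} e m i
    with e₀ , x , m₀ , mₓ , refl ←
      List.∈-cartesianProductWith⁻ _∷ʳ_ (inversionSequences n) (upTo (suc n)) m
    with view i
  ... | ‵fromℕ     = subst₂ (λ a b → a < suc b)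
    (sym (lookup-∷ʳ-fromℕ e₀ x)) (sym (Fin.toℕ-fromℕ n)) (List.∈-upTo⁻ mₓ)
  ... | ‵inject₁ j = subst₂ (λ a b → a < suc b)
    (sym (lookup-∷ʳ-inject₁ e₀ x j)) (sym (Fin.toℕ-inject₁ j)) (sound e₀ m₀ j)

∈-inversionSequences : ∀ {n} (e : Vec ℕ n) →
  e List.∈ inversionSequences n ⇔ IsInversionSequence e
∈-inversionSequences e = mk⇔ (sound e) (complete e)

inversionSequences-unique : ∀ n → Unique (inversionSequences n)
inversionSequences-unique zero    = [] ∷ []
inversionSequences-unique (suc n) =
  Unique.cartesianProductWith⁺ _∷ʳ_ (Vec.∷ʳ-injective _ _)
    (inversionSequences-unique n) (Unique.upTo⁺ (suc n))

{-# OPTIONS --safe #-}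

-- Replacing an occurrence of p by p′ on the same set of values is a bijection: the
-- maxima agree, and changeability keeps the result an inversion sequence.  Since p
-- does not overlap itself in two or more letters, the occurrences at a set S of
-- positions meet at most in their end letters, which the replacement preserves; so
-- those at S can be replaced one after the other.  Hence as many e satisfy
-- S ⊆ Em(p,e) as S ⊆ Em(p′,e), for every S, and inclusion–exclusion turns ⊆ into ≡.

module Submission where

open import Defs
open import Data.Bool.Base using (true; false; if_then_else_)
open import Data.Bool.Properties using () renaming (_≟_ to _≟ᵇ_)
open import Data.Fin.Base as Fin using (Fin; toℕ; fromℕ<)
import Data.Fin.Properties as Fin
open import Data.Fin.Subset using (Subset; Side; inside; outside; _⊆_) renaming (_∈_ to _∈ₛ_)
open import Data.Fin.Subset.Properties using (_⊆?_; _∈?_)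
open import Data.List.Base
  using (List; []; _∷_; _++_; length; map; filter; deduplicate; take; drop;
         applyUpTo; upTo; allFin)
open import Data.List.Extrema.Nat using (max; argmax-sel; xs≤max)
open import Data.List.Membership.Propositional using (_∈_)
open import Data.List.Membership.Propositional.Properties
import Data.List.Properties as List
import Data.List.Relation.Unary.All as All
open import Data.List.Relation.Unary.AllPairs using ([]; _∷_)
open import Data.List.Relation.Unary.Any using (here; there)
open import Data.List.Relation.Unary.Unique.Propositional using (Unique)
import Data.List.Relation.Unary.Unique.Propositional.Properties as Unique
open import Data.List.Relation.Unary.Unique.DecPropositional.Properties using (deduplicate-!)
open import Data.Nat.Base
open import Data.Nat.Properties
open import Data.Product.Base using (∃-syntax; _×_; _,_; proj₁; proj₂)
open import Data.Sum.Base using (_⊎_; inj₁; inj₂; [_,_]′)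
open import Data.Vec.Base as Vec using (Vec; []; _∷_; lookup; toList; tabulate)
import Data.Vec.Properties as Vec
import Data.Vec.Membership.Propositional as Vec
import Data.Vec.Membership.Propositional.Properties as Vec
import Data.Vec.Relation.Unary.Any as Vec using (index)
import Data.Vec.Relation.Unary.Any.Properties as Vec using (lookup-index)
open import Function.Base using (_∘_; id)
open import Function.Bundles using (Equivalence)
open import Relation.Binary.Definitions using (tri<; tri≈; tri>)
open import Relation.Binary.PropositionalEquality
open import Relation.Nullary
open import Relation.Nullary.Decidable using (dec-true; dec-false; _→-dec_)
open import Relation.Unary using (Decidable)

private
  variable
    A B : Set
    k n r : ℕ
    f g : ℕ → ℕ

-- Counting

-- Once `x` is matched with `y`, deleting `y` from `ys` leaves the images of the other elements in
-- place, since none of them is related to `y`. A relation instead of a function lets a pair carry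
-- evidence about its first component.
length-≤-injection : (R : A → B → Set) {xs : List A} {ys : List B} → Unique xs →
  (∀ {x} → x ∈ xs → ∃[ y ] y ∈ ys × R x y) →
  (∀ {x x′ y} → R x y → R x′ y → x ≡ x′) →
  length xs ≤ length ys
length-≤-injection R {[]}     _          _     _   = z≤n
length-≤-injection R {x ∷ xs} (x∉ ∷ uxs) total inj
  with y , y∈ys , Rxy ← total (here refl)
  with as , bs , refl ← ∈-∃++ y∈ys
  = ≤-trans (s≤s (length-≤-injection R uxs total′ inj))
            (≤-reflexive (sym (List.length-++-sucʳ as y bs)))
  where
  total′ : ∀ {x′} → x′ ∈ xs → ∃[ y′ ] y′ ∈ as ++ bs × R x′ y′
  total′ x′∈ with total (there x′∈)
  ... | y′ , y′∈ , Rx′y′ with ∈-++⁻ as y′∈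
  ... | inj₁ y′∈as         = y′ , ∈-++⁺ˡ y′∈as , Rx′y′
  ... | inj₂ (there y′∈bs) = y′ , ∈-++⁺ʳ as y′∈bs , Rx′y′
  ... | inj₂ (here refl)   =
    contradiction (inj Rxy Rx′y′) (All.lookup x∉ x′∈)

length-filter-map : {P : B → Set} (P? : Decidable P) (h : A → B) (xs : List A) →
  length (filter P? (map h xs)) ≡ length (filter (P? ∘ h) xs)
length-filter-map P? h []       = refl
length-filter-map P? h (x ∷ xs) with does (P? (h x))
... | true  = cong suc (length-filter-map P? h xs)
... | false = length-filter-map P? h xs

-- Inclusion–exclusion, one coordinate at a time

countSupersets : Subset n → List (Subset n) → ℕ
countSupersets S = length ∘ filter (S ⊆?_)

countEqual : Subset n → List (Subset n) → ℕ
countEqual T = length ∘ filter (λ U → Vec.≡-dec _≟ᵇ_ U T)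

link : Side → List (Subset (suc n)) → List (Subset n)
link b = map Vec.tail ∘ filter (λ U → Vec.head U ≟ᵇ b)

countSupersets-inside : (S : Subset n) (Us : List (Subset (suc n))) →
  countSupersets (inside ∷ S) Us ≡ countSupersets S (link inside Us)
countSupersets-inside S []                   = refl
countSupersets-inside S ((inside ∷ U) ∷ Us) with does (S ⊆? U)
... | true  = cong suc (countSupersets-inside S Us)
... | false = countSupersets-inside S Us
countSupersets-inside S ((outside ∷ U) ∷ Us) = countSupersets-inside S Us

countSupersets-outside : (S : Subset n) (Us : List (Subset (suc n))) →
  countSupersets (outside ∷ S) Us ≡
  countSupersets S (link inside Us) + countSupersets S (link outside Us)
countSupersets-outside S []                  = refl
countSupersets-outside S ((inside ∷ U) ∷ Us) with does (S ⊆? U)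
... | true  = cong suc (countSupersets-outside S Us)
... | false = countSupersets-outside S Us
countSupersets-outside S ((outside ∷ U) ∷ Us) with does (S ⊆? U)
... | true  = trans (cong suc (countSupersets-outside S Us)) (sym (+-suc _ _))
... | false = countSupersets-outside S Us

countEqual-∷ : ∀ b (T : Subset n) (Us : List (Subset (suc n))) →
  countEqual (b ∷ T) Us ≡ countEqual T (link b Us)
countEqual-∷ b T []             = refl
countEqual-∷ b T ((c ∷ U) ∷ Us) with does (c ≟ᵇ b)
... | false = countEqual-∷ b T Us
... | true  with does (Vec.≡-dec _≟ᵇ_ U T)
... | true  = cong suc (countEqual-∷ b T Us)
... | false = countEqual-∷ b T Us

-- Induction on `n`. The superset counts of the links agree again: directly for `inside`, and for
-- `outside` by subtracting the inside part from the count whose first coordinate is free. This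
-- recursion takes the place of the alternating sum.
inclusion–exclusion : (Us Vs : List (Subset n)) →
  (∀ S → countSupersets S Us ≡ countSupersets S Vs) →
  ∀ T → countEqual T Us ≡ countEqual T Vs
inclusion–exclusion {zero}  Us Vs same []      =
  trans (sym (supersets≡equal Us)) (trans (same []) (supersets≡equal Vs))
  where
  supersets≡equal : (Us : List (Subset 0)) → countSupersets [] Us ≡ countEqual [] Us
  supersets≡equal []        = refl
  supersets≡equal ([] ∷ Us) = cong suc (supersets≡equal Us)
inclusion–exclusion {suc n} Us Vs same (b ∷ T) = begin
  countEqual (b ∷ T) Us    ≡⟨ countEqual-∷ b T Us ⟩
  countEqual T (link b Us) ≡⟨ inclusion–exclusion (link b Us) (link b Vs) (same-link b) T ⟩
  countEqual T (link b Vs) ≡⟨ countEqual-∷ b T Vs ⟨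
  countEqual (b ∷ T) Vs    ∎
  where
  open ≡-Reasoning
  same-link : ∀ b S → countSupersets S (link b Us) ≡ countSupersets S (link b Vs)
  same-link inside  S = trans (sym (countSupersets-inside S Us))
    (trans (same (inside ∷ S)) (countSupersets-inside S Vs))
  same-link outside S = +-cancelˡ-≡ (countSupersets S (link inside Us)) _ _ (begin
    countSupersets S (link inside Us) + countSupersets S (link outside Us)
      ≡⟨ countSupersets-outside S Us ⟨
    countSupersets (outside ∷ S) Us
      ≡⟨ same (outside ∷ S) ⟩
    countSupersets (outside ∷ S) Vs
      ≡⟨ countSupersets-outside S Vs ⟩
    countSupersets S (link inside Vs) + countSupersets S (link outside Vs)
      ≡⟨ cong (_+ _) (same-link inside S) ⟨
    countSupersets S (link inside Us) + countSupersets S (link outside Vs) ∎)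

-- Reductions and order isomorphisms

applyUpTo-cong : ∀ k → (∀ {a} → a < k → f a ≡ g a) → applyUpTo f k ≡ applyUpTo g k
applyUpTo-cong zero    eq = refl
applyUpTo-cong (suc k) eq = cong₂ _∷_ (eq z<s) (applyUpTo-cong k (eq ∘ s<s))

applyUpTo-injective : ∀ k → applyUpTo f k ≡ applyUpTo g k → ∀ {a} → a < k → f a ≡ g a
applyUpTo-injective (suc k) eq {zero}  _         = List.∷-injectiveˡ eq
applyUpTo-injective (suc k) eq {suc a} (s≤s a<k) =
  applyUpTo-injective k (List.∷-injectiveʳ eq) a<k

take-applyUpTo : ∀ (f : ℕ → ℕ) {m n} → m ≤ n → take m (applyUpTo f n) ≡ applyUpTo f m
take-applyUpTo f z≤n       = refl
take-applyUpTo f (s≤s m≤n) = cong (f 0 ∷_) (take-applyUpTo (f ∘ suc) m≤n)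

drop-applyUpTo : ∀ (f : ℕ → ℕ) m n →
  drop m (applyUpTo f n) ≡ applyUpTo (λ a → f (m + a)) (n ∸ m)
drop-applyUpTo f zero    n       = refl
drop-applyUpTo f (suc m) zero    = refl
drop-applyUpTo f (suc m) (suc n) = drop-applyUpTo (f ∘ suc) m n

-- Both directions are recorded for `<`; together they also determine the ties. Words are functions
-- restricted to arguments below `k`, so that prefixes, suffixes and windows are mere shifts of the
-- argument.
record OrderIso (k : ℕ) (f g : ℕ → ℕ) : Set where
  field
    mono    : ∀ {a b} → a < k → b < k → f a < f b → g a < g b
    reflect : ∀ {a b} → a < k → b < k → g a < g b → f a < f b

  mono-≤ : ∀ {a b} → a < k → b < k → f a ≤ f b → g a ≤ g b
  mono-≤ a<k b<k fa≤fb = ≮⇒≥ λ gb<ga → ≤⇒≯ fa≤fb (reflect b<k a<k gb<ga)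

  mono-≡ : ∀ {a b} → a < k → b < k → f a ≡ f b → g a ≡ g b
  mono-≡ a<k b<k eq = ≤-antisym (mono-≤ a<k b<k (≤-reflexive eq))
                                (mono-≤ b<k a<k (≤-reflexive (sym eq)))

open OrderIso

OrderIso-sym : OrderIso k f g → OrderIso k g f
OrderIso-sym iso = record { mono = reflect iso ; reflect = mono iso }

OrderIso-trans : ∀ {f g h} → OrderIso k f g → OrderIso k g h → OrderIso k f h
OrderIso-trans iso iso′ = record
  { mono    = λ a< b< → mono iso′ a< b< ∘ mono iso a< b<
  ; reflect = λ a< b< → reflect iso a< b< ∘ reflect iso′ a< b<
  }

OrderIso-cong : ∀ {g′} → (∀ a → g a ≡ g′ a) → OrderIso k f g → OrderIso k f g′
OrderIso-cong eq iso = record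
  { mono    = λ a< b< → subst₂ _<_ (eq _) (eq _) ∘ mono iso a< b<
  ; reflect = λ a< b< → reflect iso a< b< ∘ subst₂ _<_ (sym (eq _)) (sym (eq _))
  }

OrderIso-take : ∀ {m} → m ≤ k → OrderIso k f g → OrderIso m f g
OrderIso-take m≤k iso = record
  { mono    = λ a< b< → mono iso (<-≤-trans a< m≤k) (<-≤-trans b< m≤k)
  ; reflect = λ a< b< → reflect iso (<-≤-trans a< m≤k) (<-≤-trans b< m≤k)
  }

OrderIso-drop : ∀ d → OrderIso k f g → OrderIso (k ∸ d) (λ a → f (d + a)) (λ a → g (d + a))
OrderIso-drop {k} d iso = record
  { mono    = λ a< b< → mono iso (shifted a<) (shifted b<)
  ; reflect = λ a< b< → reflect iso (shifted a<) (shifted b<)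
  }
  where
  shifted : ∀ {a} → a < k ∸ d → d + a < k
  shifted {a} a< = subst (_≤ k) (trans (+-comm (suc a) d) (+-suc d a))
    (m≤o∸n⇒m+n≤o (suc a) (<⇒≤ d<k) a<)
    where
    d<k : d < k
    -- The truncated difference `k ∸ d` is positive, because `a` lies below it.
    d<k = ≰⇒> λ k≤d → n≮0 (subst (a <_) (m≤n⇒m∸n≡0 k≤d) a<)

-- By definition `rank (applyUpTo f k) y` is the length of this list, so ranks can be compared
-- through injections.
distinctBelow : (ℕ → ℕ) → ℕ → ℕ → List ℕ
distinctBelow f k y = deduplicate _≟_ (filter (_<? y) (applyUpTo f k))

distinctBelow-! : ∀ f k y → Unique (distinctBelow f k y)
distinctBelow-! f k y = deduplicate-! _≟_ (filter (_<? y) (applyUpTo f k))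

∈-distinctBelow⁺ : ∀ f k y {a} → a < k → f a < y → f a ∈ distinctBelow f k y
∈-distinctBelow⁺ f k y a<k fa<y =
  ∈-deduplicate⁺ _≟_ (∈-filter⁺ (_<? y) (∈-applyUpTo⁺ f a<k) fa<y)

∈-distinctBelow⁻ : ∀ f k y {x} → x ∈ distinctBelow f k y →
  ∃[ a ] a < k × x ≡ f a × f a < y
∈-distinctBelow⁻ f k y x∈
  with x∈f , x<y ← ∈-filter⁻ (_<? y) {xs = applyUpTo f k} (∈-deduplicate⁻ _≟_ _ x∈)
  with a , a<k , refl ← ∈-applyUpTo⁻ f x∈f = a , a<k , refl , x<y

rank-mono-≤ : ∀ f k {x y} → x ≤ y → rank (applyUpTo f k) x ≤ rank (applyUpTo f k) y
rank-mono-≤ f k {x} {y} x≤y =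
  length-≤-injection _≡_ (distinctBelow-! f k x) sub λ { refl refl → refl }
  where
  sub : ∀ {z} → z ∈ distinctBelow f k x → ∃[ z′ ] z′ ∈ distinctBelow f k y × z ≡ z′
  sub z∈ with a , a<k , refl , fa<x ← ∈-distinctBelow⁻ f k x z∈ =
    _ , ∈-distinctBelow⁺ f k y a<k (<-≤-trans fa<x x≤y) , refl

-- The value `f a` lies below `y` but not below itself, so it is one additional distinct value.
rank-mono-< : ∀ f {k a y} → a < k → f a < y →
  rank (applyUpTo f k) (f a) < rank (applyUpTo f k) y
rank-mono-< f {k} {a} {y} a<k fa<y =
  length-≤-injection _≡_ (All.tabulate fresh ∷ distinctBelow-! f k (f a)) sub
    λ { refl refl → refl }
  where
  fresh : ∀ {z} → z ∈ distinctBelow f k (f a) → f a ≢ z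
  fresh z∈ with b , _ , refl , fb<fa ← ∈-distinctBelow⁻ f k (f a) z∈ = >⇒≢ fb<fa
  sub : ∀ {z} → z ∈ f a ∷ distinctBelow f k (f a) →
        ∃[ z′ ] z′ ∈ distinctBelow f k y × z ≡ z′
  sub (here refl) = _ , ∈-distinctBelow⁺ f k y a<k fa<y , refl
  sub (there z∈) with b , b<k , refl , fb<fa ← ∈-distinctBelow⁻ f k (f a) z∈ =
    _ , ∈-distinctBelow⁺ f k y b<k (<-trans fb<fa fa<y) , refl

-- Sending `f b` to `g b` takes the values below `f a` to values below `g a`. It is injective
-- because ties in `g` come from ties in `f`; the index `b` is kept in the relation to express this.
rank-≤ : OrderIso k f g → ∀ {a} → a < k →
  rank (applyUpTo f k) (f a) ≤ rank (applyUpTo g k) (g a)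
rank-≤ {k} {f} {g} iso {a} a<k = length-≤-injection
  (λ x y → ∃[ b ] b < k × x ≡ f b × y ≡ g b) (distinctBelow-! f k (f a))
  (λ x∈ → let b , b<k , x≡ , fb<fa = ∈-distinctBelow⁻ f k (f a) x∈ in
          g b , ∈-distinctBelow⁺ g k (g a) b<k (mono iso b<k a<k fb<fa) , b , b<k , x≡ , refl)
  λ { (b , b<k , refl , eq) (c , c<k , refl , eq′) →
      mono-≡ (OrderIso-sym iso) b<k c<k (trans (sym eq) eq′) }

reduction-applyUpTo : ∀ f k →
  reduction (applyUpTo f k) ≡ applyUpTo (rank (applyUpTo f k) ∘ f) k
reduction-applyUpTo f k = List.map-applyUpTo f (rank (applyUpTo f k)) k

OrderIso⇒reduction≡ : OrderIso k f g →
  reduction (applyUpTo f k) ≡ reduction (applyUpTo g k)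
OrderIso⇒reduction≡ {k} {f} {g} iso = begin
  reduction (applyUpTo f k)                ≡⟨ reduction-applyUpTo f k ⟩
  applyUpTo (rank (applyUpTo f k) ∘ f) k   ≡⟨ applyUpTo-cong k (λ a<k →
    ≤-antisym (rank-≤ iso a<k) (rank-≤ (OrderIso-sym iso) a<k)) ⟩
  applyUpTo (rank (applyUpTo g k) ∘ g) k   ≡⟨ reduction-applyUpTo g k ⟨
  reduction (applyUpTo g k)                ∎
  where open ≡-Reasoning

-- From `f a < f b` the ranks strictly increase, whereas `g b ≤ g a` would make the same ranks, read
-- off from `g`, weakly decrease.
reduction≡⇒OrderIso :
  reduction (applyUpTo f k) ≡ reduction (applyUpTo g k) → OrderIso k f g
reduction≡⇒OrderIso {f} {k} {g} eq =
  record { mono = λ a<k b<k → transfer ranks≡ a<k b<k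
         ; reflect = λ a<k b<k → transfer (sym ∘ ranks≡) a<k b<k }
  where
  ranks≡ : ∀ {a} → a < k → rank (applyUpTo f k) (f a) ≡ rank (applyUpTo g k) (g a)
  ranks≡ = applyUpTo-injective k (trans (sym (reduction-applyUpTo f k))
    (trans eq (reduction-applyUpTo g k)))
  transfer : ∀ {f g} →
    (∀ {a} → a < k → rank (applyUpTo f k) (f a) ≡ rank (applyUpTo g k) (g a)) →
    ∀ {a b} → a < k → b < k → f a < f b → g a < g b
  transfer {f} {g} ranks≡ a<k b<k fa<fb = ≰⇒> λ gb≤ga → <⇒≱ (rank-mono-< f a<k fa<fb)
    (subst₂ _≤_ (sym (ranks≡ b<k)) (sym (ranks≡ a<k)) (rank-mono-≤ g k gb≤ga))

-- Vectors as sequences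

-- Letters past the end are read as 0.
at : Vec ℕ n → ℕ → ℕ
at []       _       = 0
at (x ∷ xs) zero    = x
at (x ∷ xs) (suc i) = at xs i

lookup≡at : (xs : Vec ℕ n) (i : Fin n) → lookup xs i ≡ at xs (toℕ i)
lookup≡at (x ∷ xs) Fin.zero    = refl
lookup≡at (x ∷ xs) (Fin.suc i) = lookup≡at xs i

at-ext : (xs ys : Vec ℕ n) → (∀ {i} → i < n → at xs i ≡ at ys i) → xs ≡ ys
at-ext []       []       eq = refl
at-ext (x ∷ xs) (y ∷ ys) eq = cong₂ _∷_ (eq z<s) (at-ext xs ys (eq ∘ s<s))

at-tabulate : (h : ℕ → ℕ) {i : ℕ} → i < n → at (tabulate {n = n} (h ∘ toℕ)) i ≡ h i
at-tabulate h {zero}  (s≤s _)   = refl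
at-tabulate h {suc i} (s≤s i<n) = at-tabulate (h ∘ suc) i<n

∈⇒at : {xs : Vec ℕ n} {x : ℕ} → x Vec.∈ xs → ∃[ i ] i < n × at xs i ≡ x
∈⇒at {xs = xs} x∈ = toℕ i , Fin.toℕ<n i ,
  trans (sym (lookup≡at xs i)) (sym (Vec.lookup-index x∈))
  where i = Vec.index x∈

at∈ : (xs : Vec ℕ n) {i : ℕ} → i < n → at xs i Vec.∈ xs
at∈ xs i<n = subst (Vec._∈ xs)
  (trans (lookup≡at xs (fromℕ< i<n)) (cong (at xs) (Fin.toℕ-fromℕ< i<n)))
  (Vec.∈-lookup (fromℕ< i<n) xs)

toList≡ : (xs : Vec ℕ n) → toList xs ≡ applyUpTo (at xs) n
toList≡ []       = refl
toList≡ (x ∷ xs) = cong (x ∷_) (toList≡ xs)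

factor≡ : (xs : Vec ℕ n) (i k : ℕ) → i + k ≤ n →
  factor xs i k ≡ applyUpTo (λ a → at xs (i + a)) k
factor≡ {n} xs i k i+k≤n rewrite toList≡ xs | drop-applyUpTo (at xs) i n =
  take-applyUpTo _ (m+n≤o⇒m≤o∸n k (subst (_≤ n) (+-comm i k) i+k≤n))

-- Patterns

-- Descends from `at p a` to `x` one unit at a time by `downClosed`.
Pattern-below : (p : Vec ℕ k) → IsPattern p → ∀ {a x} → a < k → x ≤ at p a →
  ∃[ b ] b < k × at p b ≡ x
Pattern-below p pat {a} a<k x≤ = go (≤⇒≤′ x≤) (at∈ p a<k)
  where
  go : ∀ {x y} → x ≤′ y → y Vec.∈ p → ∃[ b ] b < _ × at p b ≡ x
  go ≤′-refl       y∈ = ∈⇒at y∈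
  go (≤′-step x≤y) y∈ = go x≤y (IsPattern.downClosed pat _ y∈)

-- All numbers below `at p a` occur in `p`, so there are exactly `at p a` distinct smaller values:
-- each letter is its own rank.
reduction-Pattern : (p : Vec ℕ k) → IsPattern p → reduction (toList p) ≡ toList p
reduction-Pattern {k} p pat rewrite toList≡ p =
  trans (reduction-applyUpTo (at p) k) (applyUpTo-cong k λ {a} a<k →
    ≤-antisym (upper a<k) (lower a<k))
  where
  upper : ∀ {a} → a < k → rank (applyUpTo (at p) k) (at p a) ≤ at p a
  upper {a} a<k = subst (rank (applyUpTo (at p) k) (at p a) ≤_) (List.length-upTo (at p a))
    (length-≤-injection _≡_ (distinctBelow-! (at p) k (at p a))
      (λ x∈ → let b , _ , x≡ , b< = ∈-distinctBelow⁻ (at p) k (at p a) x∈ in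
              _ , ∈-upTo⁺ b< , x≡) λ { refl refl → refl })
  lower : ∀ {a} → a < k → at p a ≤ rank (applyUpTo (at p) k) (at p a)
  lower {a} a<k = subst (_≤ rank (applyUpTo (at p) k) (at p a)) (List.length-upTo (at p a))
    (length-≤-injection _≡_ (Unique.upTo⁺ (at p a))
      (λ x∈ → let x<  = ∈-upTo⁻ x∈
                  b , b<k , b≡ = Pattern-below p pat a<k (<⇒≤ x<) in
              _ , ∈-distinctBelow⁺ (at p) k (at p a) b<k (subst (_< at p a) (sym b≡) x<) , sym b≡)
      λ { refl refl → refl })

-- Occurrences as order isomorphisms

module _ (p : Vec ℕ (suc r)) (e : Vec ℕ n) (i : Fin n) where

  -- Since `reduction` preserves length, an occurrence forces the factor to have its full length
  -- `suc r`.
  occursAt-fits : OccursAt p e i → toℕ i + suc r ≤ n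
  occursAt-fits occ = subst (_≤ n) (+-comm (suc r) (toℕ i))
    (m≤o∸n⇒m+n≤o (suc r) (<⇒≤ (Fin.toℕ<n i)) (subst (λ l → suc r ≤ l ∸ toℕ i) (Vec.length-toList e) (begin
      suc r                                            ≡⟨ Vec.length-toList p ⟨
      length (toList p)                                ≡⟨ cong length occ ⟨
      length (reduction (factor e (toℕ i) (suc r)))    ≡⟨ List.length-map (rank w) w ⟩
      length (factor e (toℕ i) (suc r))                ≡⟨ List.length-take (suc r) (drop (toℕ i) (toList e)) ⟩
      suc r ⊓ length (drop (toℕ i) (toList e))         ≤⟨ m⊓n≤n (suc r) _ ⟩
      length (drop (toℕ i) (toList e))                 ≡⟨ List.length-drop (toℕ i) (toList e) ⟩
      length (toList e) ∸ toℕ i                        ∎)))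
    where
    open ≤-Reasoning
    w = factor e (toℕ i) (suc r)

  window : ℕ → ℕ
  window a = at e (toℕ i + a)

  occursAt⁻ : IsPattern p → OccursAt p e i → OrderIso (suc r) (at p) window
  occursAt⁻ pat occ = reduction≡⇒OrderIso (begin
    reduction (applyUpTo (at p) (suc r)) ≡⟨ cong reduction (toList≡ p) ⟨
    reduction (toList p)                 ≡⟨ reduction-Pattern p pat ⟩
    toList p                             ≡⟨ occ ⟨
    reduction (factor e (toℕ i) (suc r)) ≡⟨ cong reduction
      (factor≡ e (toℕ i) (suc r) (occursAt-fits occ)) ⟩
    reduction (applyUpTo window (suc r)) ∎)
    where open ≡-Reasoning

  occursAt⁺ : IsPattern p → toℕ i + suc r ≤ n → OrderIso (suc r) (at p) window → OccursAt p e i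
  occursAt⁺ pat fits iso = begin
    reduction (factor e (toℕ i) (suc r)) ≡⟨ cong reduction (factor≡ e (toℕ i) (suc r) fits) ⟩
    reduction (applyUpTo window (suc r)) ≡⟨ OrderIso⇒reduction≡ iso ⟨
    reduction (applyUpTo (at p) (suc r)) ≡⟨ cong reduction (toList≡ p) ⟨
    reduction (toList p)                 ≡⟨ reduction-Pattern p pat ⟩
    toList p                             ∎
    where open ≡-Reasoning

-- Maxima, change bounds and the inversion condition, letter by letter

≤max⁻ : ∀ {v} (xs : List ℕ) → v ≤ max 0 xs → v ≡ 0 ⊎ ∃[ x ] x ∈ xs × v ≤ x
≤max⁻ {v} xs v≤ with argmax-sel id 0 xs
... | inj₁ max≡0 = inj₁ (n≤0⇒n≡0 (subst (v ≤_) max≡0 v≤))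
... | inj₂ max∈  = inj₂ (_ , max∈ , v≤)

≤maximum⁻ : ∀ {v} (p : Vec ℕ (suc r)) → v ≤ maximum p → ∃[ a ] a < suc r × v ≤ at p a
≤maximum⁻ p v≤ with ≤max⁻ (toList p) v≤
-- When only the default 0 of `max` bounds `v`, the first letter serves.
... | inj₁ refl = 0 , z<s , z≤n
... | inj₂ (x , x∈ , v≤x) with a , a< , refl ← ∈⇒at (Vec.∈-toList⁻ {xs = p} x∈) = a , a< , v≤x

at≤maximum : (p : Vec ℕ k) {a : ℕ} → a < k → at p a ≤ maximum p
at≤maximum p a< = All.lookup (xs≤max 0 (toList p)) (Vec.∈-toList⁺ (at∈ p a<))

-- Each alternative names a letter of `p` witnessing the bound. In the second, the subtraction is
-- moved across the inequality, so that no truncation remains; a bound that is 0 by default or by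
-- truncation falls under the first, with `b` the position of `i`.
≤changeBound⁻ : ∀ {v} (p : Vec ℕ r) (i : Fin r) → v ≤ changeBound p i →
  (∃[ b ] b ≤ toℕ i × v ≤ at p b) ⊎
  (∃[ b ] b < r × toℕ i < b × v + b ≤ at p b + toℕ i)
≤changeBound⁻ {r} {v} p i v≤ = [ (λ { refl → inj₁ (_ , ≤-refl , z≤n) }) , go ]′ (≤max⁻ _ v≤)
  where
  before = filter (Fin._≤? i) (allFin r)
  after  = filter (i Fin.<?_) (allFin r)
  fall : Fin r → ℕ
  fall j = (lookup p j + toℕ i) ∸ toℕ j
  go : ∃[ x ] x ∈ map (lookup p) before ++ map fall after × v ≤ x → _
  go (x , x∈ , v≤x) with ∈-++⁻ (map (lookup p) before) x∈
  ... | inj₁ x∈₁ with j , j∈ , refl ← ∈-map⁻ (lookup p) x∈₁ =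
    inj₁ (toℕ j , proj₂ (∈-filter⁻ (Fin._≤? i) {xs = allFin r} j∈) ,
          subst (v ≤_) (lookup≡at p j) v≤x)
  ... | inj₂ x∈₂ with j , j∈ , refl ← ∈-map⁻ fall x∈₂ with toℕ j ≤? lookup p j + toℕ i
  ...   | yes j≤ = inj₂ (toℕ j , Fin.toℕ<n j ,
          proj₂ (∈-filter⁻ (i Fin.<?_) {xs = allFin r} j∈) ,
          subst (λ l → v + toℕ j ≤ l + toℕ i) (lookup≡at p j) (m≤o∸n⇒m+n≤o v j≤ v≤x))
  ...   | no  j≰ = inj₁ (toℕ i , ≤-refl ,
          ≤-trans v≤x (≤-trans (≤-reflexive (m≤n⇒m∸n≡0 (≰⇒≥ j≰))) z≤n))

last≡at : (p : Vec ℕ (suc r)) → Vec.last p ≡ at p r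
last≡at (x ∷ [])     = refl
last≡at (x ∷ y ∷ xs) = last≡at (y ∷ xs)

head≡at : (p : Vec ℕ (suc r)) → Vec.head p ≡ at p 0
head≡at (x ∷ xs) = refl

-- Every value between `at p a` and `at p b` occurs in `p`, and each of these `d` unit steps raises
-- `f` by at least 1.
Pattern-gap : (p : Vec ℕ k) → IsPattern p → OrderIso k (at p) f →
  ∀ d {a b} → a < k → b < k → at p b ≡ d + at p a → d + f a ≤ f b
Pattern-gap p pat iso zero    a<k b<k eq = mono-≤ iso a<k b<k (≤-reflexive (sym eq))
Pattern-gap p pat iso (suc d) a<k b<k eq
  with c , c<k , pc≡ ← Pattern-below p pat b<k (subst (_ ≤_) (sym eq) (n≤1+n _)) =
  ≤-trans (s≤s (Pattern-gap p pat iso d a<k c<k pc≡))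
          (mono iso c<k b<k (subst₂ _<_ (sym pc≡) (sym eq) ≤-refl))

inversion⁻ : (e : Vec ℕ n) → IsInversionSequence e → ∀ {j} → j < n → at e j ≤ j
inversion⁻ e inv j<n = subst₂ _≤_
  (trans (lookup≡at e (fromℕ< j<n)) (cong (at e) (Fin.toℕ-fromℕ< j<n)))
  (Fin.toℕ-fromℕ< j<n) (s≤s⁻¹ (inv (fromℕ< j<n)))

inversion⁺ : (e : Vec ℕ n) → (∀ {j} → j < n → at e j ≤ j) → IsInversionSequence e
inversion⁺ e inv i = s≤s (subst (_≤ toℕ i) (sym (lookup≡at e i)) (inv (Fin.toℕ<n i)))

-- Replacing one occurrence

module _ (p p′ : Vec ℕ (suc r)) (pat : IsPattern p) (max≡ : maximum p ≡ maximum p′) where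

  private
    -- Equal maxima put `at p′ a` at or below some letter of `p`, and the values of a pattern are
    -- downward closed, so `p` has this value too. Offsets past the window are fixed, which makes
    -- `match` a function on all offsets.
    find : ∀ a → ∃[ b ] (a < suc r → b < suc r × at p b ≡ at p′ a) × (suc r ≤ a → b ≡ a)
    find a with a <? suc r
    ... | no  a≮ = a , (λ a< → contradiction a< a≮) , λ _ → refl
    ... | yes a< with c , c< , ≤c ← ≤maximum⁻ p (subst (at p′ a ≤_) (sym max≡) (at≤maximum p′ a<))
                 with b , b< , eq ← Pattern-below p pat c< ≤c
                 = b , (λ _ → b< , eq) , λ a≥ → contradiction a< (≤⇒≯ a≥)

  match : ℕ → ℕ
  match a = proj₁ (find a)

  match-< : ∀ {a} → a < suc r → match a < suc r
  match-< {a} a< = proj₁ (proj₁ (proj₂ (find a)) a<)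

  at-match : ∀ {a} → a < suc r → at p (match a) ≡ at p′ a
  at-match {a} a< = proj₂ (proj₁ (proj₂ (find a)) a<)

  match-≥ : ∀ {a} → suc r ≤ a → match a ≡ a
  match-≥ {a} = proj₂ (proj₂ (find a))

shift : (ℕ → ℕ) → ℕ → ℕ → ℕ
shift σ s j = if does (s ≤? j) then s + σ (j ∸ s) else j

shift-< : ∀ σ {s j} → j < s → shift σ s j ≡ j
shift-< σ {s} {j} j<s rewrite dec-false (s ≤? j) (<⇒≱ j<s) = refl

shift-+ : ∀ σ s a → shift σ s (s + a) ≡ s + σ a
shift-+ σ s a rewrite dec-true (s ≤? (s + a)) (m≤m+n s a) | m+n∸m≡n s a = refl

-- Presenting `j` as `s + a` keeps truncated subtraction out of the case distinctions.
data Position (s : ℕ) : ℕ → Set where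
  before : ∀ {j} → j < s → Position s j
  offset : ∀ a → Position s (s + a)

position : ∀ s j → Position s j
position s j with s ≤? j
... | yes s≤j = subst (Position s) (m+[n∸m]≡n s≤j) (offset (j ∸ s))
... | no  s≰j = before (≰⇒> s≰j)

module Replacement (p p′ : Vec ℕ (suc r)) (pat : IsPattern p) (pat′ : IsPattern p′)
                   (changeable : Changeable p p′) where

  open Changeable changeable

  -- Replacing the letter at offset a by the one at offset σ a turns an occurrence
  -- of p into one of p′ without changing its set of values; σ′ undoes this.
  σ σ′ : ℕ → ℕ
  σ  = match p p′ pat sameMaximum
  σ′ = match p′ p pat′ (sym sameMaximum)

  σ-< : ∀ {a} → a < suc r → σ a < suc r
  σ-< = match-< p p′ pat sameMaximum

  σ′-< : ∀ {a} → a < suc r → σ′ a < suc r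
  σ′-< = match-< p′ p pat′ (sym sameMaximum)

  at-σ : ∀ {a} → a < suc r → at p (σ a) ≡ at p′ a
  at-σ = at-match p p′ pat sameMaximum

  at-σ′ : ∀ {a} → a < suc r → at p′ (σ′ a) ≡ at p a
  at-σ′ = at-match p′ p pat′ (sym sameMaximum)

  -- A reindexing of `e`, hence defined whether or not `p` occurs at `s`.
  replace : ℕ → Vec ℕ n → Vec ℕ n
  replace s e = tabulate (at e ∘ shift σ s ∘ toℕ)

  at-replace-< : ∀ {s j} (e : Vec ℕ n) → j < n → j < s → at (replace s e) j ≡ at e j
  at-replace-< {s = s} e j<n j<s =
    trans (at-tabulate (at e ∘ shift σ s) j<n) (cong (at e) (shift-< σ j<s))

  at-replace-+ : ∀ (e : Vec ℕ n) s a → s + a < n → at (replace s e) (s + a) ≡ at e (s + σ a)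
  at-replace-+ e s a j<n =
    trans (at-tabulate (at e ∘ shift σ s) j<n) (cong (at e) (shift-+ σ s a))

  at-replace-≥ : ∀ (e : Vec ℕ n) s a → s + a < n → suc r ≤ a →
    at (replace s e) (s + a) ≡ at e (s + a)
  at-replace-≥ e s a j<n a≥ =
    trans (at-replace-+ e s a j<n) (cong (λ b → at e (s + b)) (match-≥ p p′ pat sameMaximum a≥))

  module _ (e : Vec ℕ n) (i : Fin n) (occ : OccursAt p e i) where

    private
      s   = toℕ i
      e′  = replace s e

      iso : OrderIso (suc r) (at p) (window p e i)
      iso = occursAt⁻ p e i pat occ

      fits : s + suc r ≤ n
      fits = occursAt-fits p e i occ

      in-range : ∀ {a} → a < suc r → s + a < n
      in-range a< = <-≤-trans (+-monoʳ-< s a<) fits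

      at-window : ∀ {a} → a < suc r → at e′ (s + a) ≡ at e (s + σ a)
      at-window a< = at-replace-+ e s _ (in-range a<)

    -- The new letter at offset `a` is the old one at `σ a`, and these compare as the letters
    -- `at p (σ a)`, which equal `at p′ a`.
    replace-occursAt : OccursAt p′ e′ i
    replace-occursAt = occursAt⁺ p′ e′ i pat′ fits record
      { mono    = λ a< b< → subst₂ _<_ (sym (at-window a<)) (sym (at-window b<))
          ∘ mono iso (σ-< a<) (σ-< b<) ∘ subst₂ _<_ (sym (at-σ a<)) (sym (at-σ b<))
      ; reflect = λ a< b< → subst₂ _<_ (at-σ a<) (at-σ b<)
          ∘ reflect iso (σ-< a<) (σ-< b<) ∘ subst₂ _<_ (at-window a<) (at-window b<)
      }

    private
      at-replace-fixed : ∀ {a} → a < suc r → at p′ a ≡ at p a → at e′ (s + a) ≡ at e (s + a)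
      at-replace-fixed a< eq = trans (at-window a<)
        (mono-≡ iso (σ-< a<) a< (trans (at-σ a<) eq))

    -- The end positions `s` and `s + r` are included: there `p` and `p′` agree, so `σ` selects a
    -- letter of `e` equal to the old one. This lets occurrences that share an end letter be
    -- replaced independently.
    replace-outside : ∀ {j} → j < n → j ≤ s ⊎ s + r ≤ j → at e′ j ≡ at e j
    replace-outside {j} j<n out with position s j
    ... | before j<s = at-replace-< e j<n j<s
    ... | offset a with suc r ≤? a
    ...   | yes a≥ = at-replace-≥ e s a j<n a≥
    ...   | no  a≱ with out
    ...     | inj₁ s+a≤s
      with refl ← n≤0⇒n≡0 (+-cancelˡ-≤ s a 0 (subst (s + a ≤_) (sym (+-identityʳ s)) s+a≤s)) =
      at-replace-fixed z<s (trans (sym (head≡at p′)) (trans (sym sameFirst) (head≡at p)))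
    ...     | inj₂ s+r≤s+a
      with refl ← ≤-antisym (+-cancelˡ-≤ s r a s+r≤s+a) (s≤s⁻¹ (≰⇒> a≱)) =
      at-replace-fixed ≤-refl (trans (sym (last≡at p′)) (trans (sym sameLast) (last≡at p)))

    replace-inversion : IsInversionSequence e → IsInversionSequence e′
    replace-inversion inv = inversion⁺ e′ bound
      where
      bound-e : ∀ {j} → j < n → at e j ≤ j
      bound-e = inversion⁻ e inv

      -- The value of p at σ a is the value of p′ at a, so the letter e (s + σ a) is
      -- bounded by whichever letter of e witnesses the bound on p′ at a; in the
      -- second case the gap d between the values of p is also a gap in e.
      bound-σ : ∀ {a} → a < suc r → at e (s + σ a) ≤ s + a
      bound-σ {a} a< with ≤changeBound⁻ p (fromℕ< a<) (change (fromℕ< a<))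
      ... | c rewrite lookup≡at p′ (fromℕ< a<) | Fin.toℕ-fromℕ< a< | sym (at-σ a<) with c
      ...   | inj₁ (b , b≤a , ≤pb) = begin
        at e (s + σ a) ≤⟨ mono-≤ iso (σ-< a<) b< ≤pb ⟩
        at e (s + b)   ≤⟨ bound-e (in-range b<) ⟩
        s + b          ≤⟨ +-monoʳ-≤ s b≤a ⟩
        s + a          ∎
        where
        open ≤-Reasoning
        b< = ≤-<-trans b≤a a<
      ...   | inj₂ (b , b< , a<b , ≤pb) = +-cancelˡ-≤ d _ _ (begin
        d + at e (s + σ a) ≤⟨ Pattern-gap p pat iso d (σ-< a<) b< (sym (m∸n+n≡m pσa≤pb)) ⟩
        at e (s + b)       ≤⟨ bound-e (in-range b<) ⟩
        s + b              ≤⟨ +-monoʳ-≤ s b≤d+a ⟩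
        s + (d + a)        ≡⟨ +-assoc s d a ⟨
        (s + d) + a        ≡⟨ cong (_+ a) (+-comm s d) ⟩
        (d + s) + a        ≡⟨ +-assoc d s a ⟩
        d + (s + a)        ∎)
        where
        open ≤-Reasoning
        pσa = at p (σ a)
        d   = at p b ∸ pσa
        -- As `a < b`, the witnessed inequality forces this, so the difference `d` is not truncated.
        pσa≤pb : pσa ≤ at p b
        pσa≤pb = +-cancelʳ-≤ b _ _ (≤-trans ≤pb (+-monoʳ-≤ (at p b) (<⇒≤ a<b)))
        b≤d+a : b ≤ d + a
        b≤d+a = +-cancelˡ-≤ pσa _ _ (begin
          pσa + b       ≤⟨ ≤pb ⟩
          at p b + a    ≡⟨ cong (_+ a) (m+[n∸m]≡n pσa≤pb) ⟨
          pσa + d + a   ≡⟨ +-assoc pσa d a ⟩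
          pσa + (d + a) ∎)

      bound : ∀ {j} → j < n → at e′ j ≤ j
      bound {j} j<n with position s j
      ... | before j<s = subst (_≤ j) (sym (at-replace-< e j<n j<s)) (bound-e j<n)
      ... | offset a with a <? suc r
      ...   | yes a< = subst (_≤ s + a) (sym (at-replace-+ e s a j<n)) (bound-σ a<)
      ...   | no  a≮ = subst (_≤ s + a) (sym (at-replace-≥ e s a j<n (≮⇒≥ a≮))) (bound-e j<n)

    -- With repeated letters `σ (σ′ a)` may differ from `a`, but `p` has the same value at both
    -- offsets, hence so does the window of `e`.
    restore : ∀ {a} → a < suc r → at e (s + a) ≡ at e′ (s + σ′ a)
    restore {a} a< = sym (trans (at-window (σ′-< a<))
      (mono-≡ iso (σ-< (σ′-< a<)) a< (trans (at-σ (σ′-< a<)) (at-σ′ a<))))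

  -- Inside the window `restore` reads the old letters off the new sequence by means of `σ′`, which
  -- does not depend on the sequence; elsewhere nothing has changed.
  replace-injective : (e₁ e₂ : Vec ℕ n) (i : Fin n) →
    OccursAt p e₁ i → OccursAt p e₂ i →
    replace (toℕ i) e₁ ≡ replace (toℕ i) e₂ → e₁ ≡ e₂
  replace-injective {n} e₁ e₂ i occ₁ occ₂ eq = at-ext e₁ e₂ same
    where
    s = toℕ i
    unchanged : ∀ {j} → at (replace s e₁) j ≡ at e₁ j → at (replace s e₂) j ≡ at e₂ j →
                at e₁ j ≡ at e₂ j
    unchanged {j} eq₁ eq₂ = trans (sym eq₁) (trans (cong (λ e → at e j) eq) eq₂)
    same : ∀ {j} → j < n → at e₁ j ≡ at e₂ j
    same {j} j<n with position s j
    ... | before j<s = unchanged (at-replace-< e₁ j<n j<s) (at-replace-< e₂ j<n j<s)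
    ... | offset a with a <? suc r
    ...   | yes a< = trans (restore e₁ i occ₁ a<)
      (trans (cong (λ e → at e (s + σ′ a)) eq) (sym (restore e₂ i occ₂ a<)))
    ...   | no  a≮ = unchanged
      (at-replace-≥ e₁ s a j<n (≮⇒≥ a≮)) (at-replace-≥ e₂ s a j<n (≮⇒≥ a≮))

-- Counting with a prescribed set of occurrences

-- At a distance `d` with 0 < `d` < `r`, the two windows share `m` letters with 1 < `m` < `suc r`.
-- The prefix and the suffix of `p` of length `m` would then have the same reduction.
occurrences-spaced : (p : Vec ℕ (suc r)) → IsPattern p → NonOverlapping p →
  (e : Vec ℕ n) (i j : Fin n) → OccursAt p e i → OccursAt p e j →
  toℕ i < toℕ j → toℕ i + r ≤ toℕ j
occurrences-spaced {r} p pat non e i j occᵢ occⱼ i<j = ≮⇒≥ λ j<i+r →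
  non m (m+n≤o⇒m≤o∸n 2 (s≤s (d<r j<i+r))) (s≤s m≤r) (begin
    reduction (take m (toList p))
      ≡⟨ cong (reduction ∘ take m) (toList≡ p) ⟩
    reduction (take m (applyUpTo (at p) (suc r)))
      ≡⟨ cong reduction (take-applyUpTo (at p) m≤) ⟩
    reduction (applyUpTo (at p) m)
      ≡⟨ OrderIso⇒reduction≡ selfOverlap ⟩
    reduction (applyUpTo (λ a → at p (d + a)) m)
      ≡⟨ cong reduction (drop-applyUpTo (at p) d (suc r)) ⟨
    reduction (drop d (applyUpTo (at p) (suc r)))
      ≡⟨ cong (λ d → reduction (drop d (applyUpTo (at p) (suc r))))
              (m∸[m∸n]≡n (m≤n⇒m≤1+n (<⇒≤ (d<r j<i+r)))) ⟨
    reduction (drop (suc r ∸ m) (applyUpTo (at p) (suc r)))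
      ≡⟨ cong (reduction ∘ drop (suc r ∸ m)) (toList≡ p) ⟨
    reduction (drop (suc r ∸ m) (toList p)) ∎)
  where
  open ≡-Reasoning
  d = toℕ j ∸ toℕ i
  m = suc r ∸ d
  i+d≡j : toℕ i + d ≡ toℕ j
  i+d≡j = m+[n∸m]≡n (<⇒≤ i<j)
  0<d : 0 < d
  0<d = m<n⇒0<n∸m i<j
  d<r : toℕ j < toℕ i + r → d < r
  d<r j< = +-cancelˡ-< (toℕ i) d r (subst (_< toℕ i + r) (sym i+d≡j) j<)
  m≤ : m ≤ suc r
  m≤ = m∸n≤m (suc r) d
  m≤r : m ≤ r
  m≤r = ∸-monoʳ-≤ (suc r) 0<d
  -- The shared stretch of `e` is the start of the window at `j` and the end of the window at `i`.
  selfOverlap : OrderIso m (at p) (λ a → at p (d + a))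
  selfOverlap = OrderIso-trans
    (OrderIso-cong (λ a → cong (at e) (trans (cong (_+ a) (sym i+d≡j)) (+-assoc (toℕ i) d a)))
      (OrderIso-take m≤ (occursAt⁻ p e j pat occⱼ)))
    (OrderIso-sym (OrderIso-drop d (occursAt⁻ p e i pat occᵢ)))

count : {P : Vec ℕ n → Set} → Decidable P → ℕ
count {n} P? = length (filter P? (inversionSequences n))

-- Injectivity is asked only on `P`, since `replace` can be undone only where `p` occurs.
count-≤-injection : {P Q : Vec ℕ n → Set} (P? : Decidable P) (Q? : Decidable Q)
  (h : Vec ℕ n → Vec ℕ n) →
  (∀ e → IsInversionSequence e → P e → IsInversionSequence (h e) × Q (h e)) →
  (∀ {e e′} → P e → P e′ → h e ≡ h e′ → e ≡ e′) →
  count P? ≤ count Q?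
count-≤-injection {n} {P} P? Q? h h∈ inj = length-≤-injection (λ e e′ → P e × h e ≡ e′)
  (Unique.filter⁺ P? (inversionSequences-unique n))
  (λ {e} e∈ → let e∈I , Pe = ∈-filter⁻ P? {xs = inversionSequences n} e∈
                  inv , Q  = h∈ e (to (∈-inversionSequences e) e∈I) Pe in
    h e , ∈-filter⁺ Q? (from (∈-inversionSequences (h e)) inv) Q , Pe , refl)
  λ { (Pe , refl) (Pe′ , eq) → inj Pe Pe′ (sym eq) }
  where open Equivalence

-- Switching the occurrences from left to right

module Mixture (p p′ : Vec ℕ (suc r)) (S : Subset n) where

  -- Interpolates between `p` everywhere, at `t` = 0, and `p′` everywhere, at `t` = `n`: positions
  -- below `t` have already been switched.
  mixed : ℕ → ℕ → Vec ℕ (suc r)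
  mixed t j = if does (j <? t) then p′ else p

  mixed-< : ∀ {t j} → j < t → mixed t j ≡ p′
  mixed-< {t} {j} j<t rewrite dec-true (j <? t) j<t = refl

  mixed-≥ : ∀ {t j} → t ≤ j → mixed t j ≡ p
  mixed-≥ {t} {j} t≤j rewrite dec-false (j <? t) (≤⇒≯ t≤j) = refl

  mixed-suc : ∀ {t j} → j ≢ t → mixed t j ≡ mixed (suc t) j
  mixed-suc {t} {j} j≢t with <-cmp j t
  ... | tri< j<t _ _ = trans (mixed-< j<t) (sym (mixed-< (m<n⇒m<1+n j<t)))
  ... | tri≈ _ j≡t _ = contradiction j≡t j≢t
  ... | tri> _ _ t<j = trans (mixed-≥ (<⇒≤ t<j)) (sym (mixed-≥ t<j))

  Mixed : ℕ → Vec ℕ n → Set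
  Mixed t e = ∀ i → i ∈ₛ S → OccursAt (mixed t (toℕ i)) e i

  mixed? : ∀ t → Decidable (Mixed t)
  mixed? t e = Fin.all? λ i → (i ∈? S) →-dec occursAt? (mixed t (toℕ i)) e i

  -- A condition on `S` alone, so it persists while the sequence is being changed.
  Spaced : Set
  Spaced = ∀ i j → i ∈ₛ S → j ∈ₛ S → toℕ i < toℕ j → toℕ i + r ≤ toℕ j

module _ (p p′ : Vec ℕ (suc r)) (pat : IsPattern p) (pat′ : IsPattern p′)
         (non : NonOverlapping p) (changeable : Changeable p p′)
         (S : Subset n) where

  open Replacement p p′ pat pat′ changeable

  open Mixture p p′ S

  -- `mixed 0` computes to `p` at every position, so the spacing of occurrences of `p` applies.
  mixed⇒spaced : ∀ e → Mixed 0 e → Spaced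
  mixed⇒spaced e mix i j i∈ j∈ = occurrences-spaced p pat non e i j (mix i i∈) (mix j j∈)

  module _ (spaced : Spaced) (s : Fin n) (s∈ : s ∈ₛ S) where

    private t = toℕ s

    mixed-at : ∀ e → Mixed t e → OccursAt p e s
    mixed-at e mix = subst (λ q → OccursAt q e s) (mixed-≥ {t} {t} ≤-refl) (mix s s∈)

    -- At `s` the replacement creates `p′`. Any other window at a position of `S` meets the one at
    -- `s` in at most an end letter, so its factor is unchanged.
    mixed-replace : ∀ e → Mixed t e → Mixed (suc t) (replace t e)
    mixed-replace e mix i i∈ with i Fin.≟ s
    ... | yes refl = subst (λ q → OccursAt q (replace t e) s) (sym (mixed-< {suc t} {t} ≤-refl))
                           (replace-occursAt e s (mixed-at e mix))
    ... | no  i≢s  = begin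
      reduction (factor (replace t e) (toℕ i) (suc r)) ≡⟨ cong reduction unchanged ⟩
      reduction (factor e (toℕ i) (suc r))             ≡⟨ mix i i∈ ⟩
      toList (mixed t (toℕ i))                         ≡⟨ cong toList (mixed-suc i≢t) ⟩
      toList (mixed (suc t) (toℕ i))                   ∎
      where
      open ≡-Reasoning
      i≢t : toℕ i ≢ t
      i≢t = i≢s ∘ Fin.toℕ-injective
      fits : toℕ i + suc r ≤ n
      fits = occursAt-fits (mixed t (toℕ i)) e i (mix i i∈)
      outside-window : ∀ {a} → a < suc r → toℕ i + a ≤ t ⊎ t + r ≤ toℕ i + a
      outside-window {a} a< with <-cmp (toℕ i) t
      ... | tri< i<s _ _ = inj₁ (≤-trans (+-monoʳ-≤ (toℕ i) (s≤s⁻¹ a<)) (spaced i s i∈ s∈ i<s))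
      ... | tri≈ _ i≡s _ = contradiction (Fin.toℕ-injective i≡s) i≢s
      ... | tri> _ _ s<i = inj₂ (≤-trans (spaced s i s∈ i∈ s<i) (m≤m+n (toℕ i) a))
      unchanged : factor (replace t e) (toℕ i) (suc r) ≡ factor e (toℕ i) (suc r)
      unchanged = trans (factor≡ (replace t e) (toℕ i) (suc r) fits)
        (trans (applyUpTo-cong (suc r) λ a< → replace-outside e s (mixed-at e mix)
                 (<-≤-trans (+-monoʳ-< (toℕ i) a<) fits) (outside-window a<))
               (sym (factor≡ e (toℕ i) (suc r) fits)))

    count-replace : count (mixed? t) ≤ count (mixed? (suc t))
    count-replace = count-≤-injection (mixed? t) (mixed? (suc t)) (replace t)
      (λ e inv mix → replace-inversion e s (mixed-at e mix) inv , mixed-replace e mix)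
      (λ {e} {e′} mix mix′ → replace-injective e e′ s (mixed-at e mix) (mixed-at e′ mix′))

  count-step : Spaced → ∀ {t} → t < n → count (mixed? t) ≤ count (mixed? (suc t))
  count-step spaced {t} t<n with fromℕ< t<n ∈? S
  ... | yes s∈ = subst (λ t → count (mixed? t) ≤ count (mixed? (suc t))) (Fin.toℕ-fromℕ< t<n)
    (count-replace spaced (fromℕ< t<n) s∈)
  -- Nothing is prescribed at `t` itself, and at all other positions both stages prescribe the same
  -- pattern.
  ... | no  s∉ = count-≤-injection (mixed? t) (mixed? (suc t)) id
    (λ e inv mix → inv , λ i i∈ → subst (λ q → OccursAt q e i)
      (mixed-suc {t} {toℕ i} λ { refl → s∉ (subst (_∈ₛ S) (sym (Fin.fromℕ<-toℕ i t<n)) i∈) }) (mix i i∈))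
    (λ _ _ → id)

  count-mixed : Spaced → ∀ t → t ≤ n → count (mixed? 0) ≤ count (mixed? t)
  count-mixed spaced zero    _   = ≤-refl
  count-mixed spaced (suc t) t<n =
    ≤-trans (count-mixed spaced t (<⇒≤ t<n)) (count-step spaced t<n)

  -- If no inversion sequence satisfies `Mixed 0`, the bound is trivial; otherwise any one that does
  -- shows that `S` is spaced, as the successive replacements require.
  count-mixed-n : count (mixed? 0) ≤ count (mixed? n)
  count-mixed-n with filter (mixed? 0) (inversionSequences n) in eq
  ... | []    = z≤n
  ... | e ∷ _ = subst (λ es → length es ≤ count (mixed? n)) eq
    (count-mixed (mixed⇒spaced e (proj₂ (∈-filter⁻ (mixed? 0) {xs = inversionSequences n}
      (subst (e ∈_) (sym eq) (here refl))))) n ≤-refl)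

-- From prescribed occurrences to the sets `Em`

∈-Em⁺ : (p : Vec ℕ r) (e : Vec ℕ n) {i : Fin n} → OccursAt p e i → i ∈ₛ Em p e
∈-Em⁺ p e {i} occ = Vec.lookup⇒[]= i (Em p e)
  (trans (Vec.lookup∘tabulate _ i) (dec-true (occursAt? p e i) occ))

∈-Em⁻ : (p : Vec ℕ r) (e : Vec ℕ n) {i : Fin n} → i ∈ₛ Em p e → OccursAt p e i
∈-Em⁻ p e {i} i∈
  with occursAt? p e i
     | trans (sym (Vec.lookup∘tabulate (does ∘ occursAt? p e) i)) (Vec.[]=⇒lookup i∈)
... | yes occ | _  = occ
... | no  _   | ()

-- Containment of `S` in `Em p e` is `Mixed 0`, and containment in `Em p′ e` is `Mixed n`.
countSupersets-≤ : (p p′ : Vec ℕ (suc r)) → IsPattern p → IsPattern p′ →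
  NonOverlapping p → Changeable p p′ → (S : Subset n) →
  countSupersets S (map (Em p) (inversionSequences n)) ≤
  countSupersets S (map (Em p′) (inversionSequences n))
countSupersets-≤ {n = n} p p′ pat pat′ non changeable S = begin
  countSupersets S (map (Em p) I)
    ≡⟨ length-filter-map (S ⊆?_) (Em p) I ⟩
  count (λ e → S ⊆? Em p e)
    ≡⟨ cong length (List.filter-≐ (λ e → S ⊆? Em p e) (mixed? 0)
         ((λ {e} → start⁺ e) , λ {e} → start⁻ e) I) ⟩
  count (mixed? 0)
    ≤⟨ count-mixed-n p p′ pat pat′ non changeable S ⟩
  count (mixed? n)
    ≡⟨ cong length (List.filter-≐ (mixed? n) (λ e → S ⊆? Em p′ e)
         ((λ {e} → end⁺ e) , λ {e} → end⁻ e) I) ⟩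
  count (λ e → S ⊆? Em p′ e)
    ≡⟨ length-filter-map (S ⊆?_) (Em p′) I ⟨
  countSupersets S (map (Em p′) I) ∎
  where
  open ≤-Reasoning
  I = inversionSequences n
  open Mixture p p′ S
  start⁺ : ∀ e → S ⊆ Em p e → Mixed 0 e
  start⁺ e S⊆ i i∈ = ∈-Em⁻ p e (S⊆ i∈)
  start⁻ : ∀ e → Mixed 0 e → S ⊆ Em p e
  start⁻ e mix i∈ = ∈-Em⁺ p e (mix _ i∈)
  atEnd : ∀ i → mixed n (toℕ {n} i) ≡ p′
  atEnd i = mixed-< (Fin.toℕ<n i)
  end⁺ : ∀ e → Mixed n e → S ⊆ Em p′ e
  end⁺ e mix {i} i∈ = ∈-Em⁺ p′ e (subst (λ q → OccursAt q e i) (atEnd i) (mix i i∈))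
  end⁻ : ∀ e → S ⊆ Em p′ e → Mixed n e
  end⁻ e S⊆ i i∈ = subst (λ q → OccursAt q e i) (sym (atEnd i)) (∈-Em⁻ p′ e (S⊆ i∈))

mainTheorem3 : ∀ {r} (p p′ : Vec ℕ (suc r)) →
    IsPattern p → IsPattern p′ →
    NonOverlapping p → NonOverlapping p′ →
    Interchangeable p p′ →
    SuperStronglyWilfEquivalent p p′
mainTheorem3 p p′ pat pat′ non non′ (changeable , changeable′) n T = begin
  countEm p T                  ≡⟨ length-filter-map (λ U → Vec.≡-dec _≟ᵇ_ U T) (Em p) I ⟨
  countEqual T (map (Em p) I)  ≡⟨ inclusion–exclusion (map (Em p) I) (map (Em p′) I) (λ S → ≤-antisym
    -- Each direction of interchangeability gives an injection, hence one of the two inequalities.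
    (countSupersets-≤ p p′ pat pat′ non changeable S)
    (countSupersets-≤ p′ p pat′ pat non′ changeable′ S)) T ⟩
  countEqual T (map (Em p′) I) ≡⟨ length-filter-map (λ U → Vec.≡-dec _≟ᵇ_ U T) (Em p′) I ⟩
  countEm p′ T                 ∎
  where
  open ≡-Reasoning
  I = inversionSequences n
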